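{- Let $c,k$ be fixed positive integers with $c\le k$, and let $s=s(n)$ be an integer-valued function with $s(n)\ge c$ for all $n$. If $s(n)=o(n^{1/c^2})$ as $n\to\infty$, then $p(n,c,k,s(n))=o(1)$, i.e. $\lim_{n\to\infty}p(n,c,k,s(n))=0$.
   Context: $C_n^k$ denotes the $k$-th power of the cycle on $n$ vertices: its vertex set is $\{0,\ldots,n-1\}$, and distinct vertices $i,j$ are adjacent iff $(i-j) \bmod n\in\{ -k,\ldots,-1,1,\ldots,k\}$ (residues modulo $n$), i.e. iff their distance along the cycle is at most $k$. Given a set $L(x)$ of colours for each vertex $x$ of a graph $G$, an $L$-colouring of $G$ is a map $f$ from $V(G)$ to the colours with $f(x)\in L(x)$ for all $x\in V(G)$ and $f(x)\ne f(y)$ for every edge $(x,y)\in E(G)$; $G$ is $L$-colourable if it has an $L$-colouring. Let $\mathcal{S}$ be a set of colours of size $s(n)$. For each vertex of $C_n^k$, independently, draw a subset of $\mathcal{S}$ of size $c$ uniformly at random among all $c$-element subsets of $\mathcal{S}$; this gives a random list assignment $L$. Then $p(n,c,k,s(n))$ is the probability that $C_n^k$ is $L$-colourable. The parameters $c,k$ are fixed and all asymptotics are as $n\to\infty$; $f=o(g)$ means $\lim_{n\to\infty} f/g=0$. -}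

module Defs where

import Algebra.Definitions.RawSemiring
open import Data.Bool.Base using (Bool; true; false)
open import Data.Fin.Base using (Fin; zero; suc; toℕ)
open import Data.Fin.Properties using (any?; all?) renaming (_≟_ to _≟ᶠ_)
open import Data.Fin.Subset using (Subset; inside; outside; ∣_∣; _∈_)
open import Data.Fin.Subset.Properties using (_∈?_)
open import Data.Integer.Base as ℤ using (ℤ; +_; -[1+_])
open import Data.Integer.Divisibility using () renaming (_∣_ to _∣ᶻ_)
open import Data.List.Base as List using (List; []; _∷_; length; filter; cartesianProductWith)
import Data.List.Membership.Propositional as List
open import Data.List.Membership.Propositional.Properties using (∈-cartesianProductWith⁺; ∈-filter⁺)
open import Data.List.Relation.Unary.Any using (here; there)
open import Data.Nat.Base as ℕ using (ℕ; zero; suc; NonZero; _≤_; _<_; z≤n; s≤s)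
import Data.Nat.Divisibility as ℕ
open import Data.Nat.Properties using (anyUpTo?) renaming (_≟_ to _≟ⁿ_; _≤?_ to _≤?ⁿ_)
open import Data.Product.Base using (Σ-syntax; ∃-syntax; _×_; _,_; proj₁; proj₂)
open import Data.Rational as ℚ using (ℚ; 0ℚ; +-*-rawSemiring)
open import Data.Sum.Base using (_⊎_; inj₁; inj₂)
open import Data.Vec.Base as Vec using (Vec; []; _∷_; lookup; tabulate)
open import Data.Vec.Properties using (lookup∘tabulate)
open import Relation.Binary.Core using (Rel)
open import Relation.Binary.Definitions using (Decidable)
open import Relation.Binary.PropositionalEquality using (_≡_; _≢_; refl; sym; cong; subst; subst₂)
open import Relation.Nullary.Decidable using (Dec; yes; no; map′; ¬?; _×-dec_; _⊎-dec_; _→-dec_)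
open import Relation.Unary using (Pred) renaming (Decidable to Decidable₁)
open import Level using (0ℓ)

------------------------------------------------------------------------
-- Powers of cycles

-- d ranges over {-k,…,-1,1,…,k}, and the divisibility says that i - j and d
-- are the same residue modulo n.
CycleAdj : (n k : ℕ) → Rel (Fin n) 0ℓ
CycleAdj n k i j =
  i ≢ j × ∃[ d ] (1 ≤ ℤ.∣ d ∣ × ℤ.∣ d ∣ ≤ k ×
                  (+ n) ∣ᶻ ((+ toℕ i ℤ.- + toℕ j) ℤ.- d))

cycleAdj? : ∀ n k → Decidable (CycleAdj n k)
cycleAdj? n k i j = ¬? (i ≟ᶠ j) ×-dec map′ to from
  (anyUpTo? (λ m → (1 ≤?ⁿ m) ×-dec (div? (+ m) ⊎-dec div? (ℤ.- (+ m)))) (suc k))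
  where
  Div : ℤ → Set
  Div d = (+ n) ∣ᶻ ((+ toℕ i ℤ.- + toℕ j) ℤ.- d)

  div? : Decidable₁ Div
  div? d = n ℕ.∣? ℤ.∣ (+ toℕ i ℤ.- + toℕ j) ℤ.- d ∣

  to : ∃[ m ] (m < suc k × 1 ≤ m × (Div (+ m) ⊎ Div (ℤ.- (+ m)))) →
       ∃[ d ] (1 ≤ ℤ.∣ d ∣ × ℤ.∣ d ∣ ≤ k × Div d)
  to (m     , s≤s m≤k , 1≤m , inj₁ p) = + m , 1≤m , m≤k , p
  to (suc m , s≤s m≤k , 1≤m , inj₂ p) = -[1+ m ] , 1≤m , m≤k , p

  from : ∃[ d ] (1 ≤ ℤ.∣ d ∣ × ℤ.∣ d ∣ ≤ k × Div d) →
         ∃[ m ] (m < suc k × 1 ≤ m × (Div (+ m) ⊎ Div (ℤ.- (+ m))))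
  from (+ m      , 1≤m , m≤k , p) = m , s≤s m≤k , 1≤m , inj₁ p
  from (-[1+ m ] , 1≤m , m≤k , p) = suc m , s≤s m≤k , 1≤m , inj₂ p

------------------------------------------------------------------------
-- List colourings of a graph on Fin n, with colours in Fin s

module _ {n s : ℕ} where

  IsListColouring : Rel (Fin n) 0ℓ → (Fin n → Subset s) → (Fin n → Fin s) → Set
  IsListColouring Adj L f =
    (∀ x → f x ∈ L x) × (∀ x y → Adj x y → f x ≢ f y)

  ListColourable : Rel (Fin n) 0ℓ → (Fin n → Subset s) → Set
  ListColourable Adj L = ∃[ f ] IsListColouring Adj L f

anyVec? : ∀ {s} n {P : Pred (Vec (Fin s) n) 0ℓ} → Decidable₁ P → Dec (∃[ v ] P v)
anyVec? zero    P? = map′ ([] ,_) (λ { ([] , p) → p }) (P? [])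
anyVec? (suc n) P? = map′ (λ (x , v , p) → x ∷ v , p) (λ { (x ∷ v , p) → x , v , p })
  (any? λ x → anyVec? n λ v → P? (x ∷ v))

listColourable? : ∀ {n s} {Adj : Rel (Fin n) 0ℓ} → Decidable Adj →
                  (L : Fin n → Subset s) → Dec (ListColourable Adj L)
listColourable? {n} {Adj = Adj} adj? L = map′
  (λ (v , p) → lookup v , p)
  (λ (f , p , q) → tabulate f
    , (λ x → subst (_∈ L x) (sym (lookup∘tabulate f x)) (p x))
    , (λ x y a → subst₂ _≢_ (sym (lookup∘tabulate f x)) (sym (lookup∘tabulate f y)) (q x y a)))
  (anyVec? n λ v →
    all? (λ x → lookup v x ∈? L x) ×-dec
    all? (λ x → all? λ y → adj? x y →-dec ¬? (lookup v x ≟ᶠ lookup v y)))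

------------------------------------------------------------------------
-- Random lists

-- All vectors of length n with entries in xs, each listed once if xs has no
-- repetitions.
allVecs : ∀ {A : Set} → List A → (n : ℕ) → List (Vec A n)
allVecs xs zero    = [] ∷ []
allVecs xs (suc n) = cartesianProductWith _∷_ xs (allVecs xs n)

subsetsOfSize : (c s : ℕ) → List (Subset s)
subsetsOfSize c s = filter (λ p → ∣ p ∣ ≟ⁿ c) (allVecs (inside ∷ outside ∷ []) s)

-- Drawing the n lists independently and uniformly is the same as drawing one
-- element of this product uniformly.
listAssignments : (n c s : ℕ) → List (Vec (Subset s) n)
listAssignments n c s = allVecs (subsetsOfSize c s) n

∈-allVecs : ∀ {A : Set} {xs : List A} n (v : Vec A n) →
            (∀ i → lookup v i List.∈ xs) → v List.∈ allVecs xs n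
∈-allVecs zero    []      h = here refl
∈-allVecs (suc n) (x ∷ v) h =
  ∈-cartesianProductWith⁺ _∷_ (h zero) (∈-allVecs n v λ i → h (suc i))

subsetOfSize : ∀ {c s} → c ≤ s → Σ[ p ∈ Subset s ] ∣ p ∣ ≡ c
subsetOfSize {s = zero}  z≤n     = [] , refl
subsetOfSize {s = suc s} z≤n     = let p , eq = subsetOfSize {s = s} z≤n in outside ∷ p , eq
subsetOfSize             (s≤s h) = let p , eq = subsetOfSize h in inside ∷ p , cong suc eq

listAssignments-nonZero : ∀ n {c s} → c ≤ s → NonZero (length (listAssignments n c s))
listAssignments-nonZero n {c} {s} c≤s =
  nonEmpty (∈-allVecs n (tabulate λ _ → p) λ i →
    subst (List._∈ subsetsOfSize c s) (sym (lookup∘tabulate (λ _ → p) i))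
      (∈-filter⁺ (λ q → ∣ q ∣ ≟ⁿ c) (∈-allVecs s p λ j → ∈-bool (lookup p j)) ∣p∣≡c))
  where
  p = proj₁ (subsetOfSize c≤s)
  ∣p∣≡c = proj₂ (subsetOfSize c≤s)

  ∈-bool : ∀ b → b List.∈ (inside ∷ outside ∷ [])
  ∈-bool true  = here refl
  ∈-bool false = there (here refl)

  nonEmpty : ∀ {A : Set} {x : A} {xs} → x List.∈ xs → NonZero (length xs)
  nonEmpty {xs = _ ∷ _} _ = _

uniformProb : ∀ {A : Set} (Ω : List A) .{{_ : NonZero (length Ω)}}
              {P : Pred A 0ℓ} → Decidable₁ P → ℚ
uniformProb Ω P? = (+ length (filter P? Ω)) ℚ./ length Ω

colourProb : (n c k s : ℕ) → c ≤ s → ℚ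
colourProb n c k s c≤s =
  uniformProb (listAssignments n c s) {{listAssignments-nonZero n c≤s}}
    (λ L → listColourable? (cycleAdj? n k) (lookup L))

------------------------------------------------------------------------
-- Asymptotics

fromℕ : ℕ → ℚ
fromℕ n = + n ℚ./ 1

open Algebra.Definitions.RawSemiring +-*-rawSemiring public using (_^_)

TendsToZero : (ℕ → ℚ) → Set
TendsToZero a = ∀ (ε : ℚ) → 0ℚ ℚ.< ε →
  ∃[ N ] ∀ n → N ≤ n → ℚ.∣ a n ∣ ℚ.< ε

-- s(n) = o(n^(1/m)) for m ≥ 1. The real number n^(1/m) is not available, so
-- s(n) / n^(1/m) < ε is written with both sides of s(n) < ε n^(1/m), which are
-- nonnegative, raised to the m-th power. Rational ε suffice by density.
IsLittleORoot : (s : ℕ → ℕ) (m : ℕ) → Set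
IsLittleORoot s m = ∀ (ε : ℚ) → 0ℚ ℚ.< ε →
  ∃[ N ] ∀ n → N ≤ n → fromℕ (s n) ^ m ℚ.< ε ^ m ℚ.* fromℕ n

{-# OPTIONS --safe #-}
-- Any c + 1 ≤ k + 1 consecutive vertices form a clique, so a list assignment
-- giving them one and the same list of size c admits no colouring. With N
-- available lists and A = N ^ c, each of the m = ⌊n / (c + 1)⌋ disjoint windows
-- of c + 1 vertices is constant with probability 1 / A, hence
-- p ≤ (1 - 1 / A) ^ m ≤ A / (A + m), where A ≤ s ^ (c * c) = o(n).
module Submission where

open import Defs renaming (_^_ to _^ℚ_)
open import Algebra.Bundles using (CommutativeMonoid)
open import Algebra.Properties.CommutativeSemigroup using (interchange)
open import Data.Bool.Base using (true; false)
open import Data.Bool.Properties using () renaming (_≟_ to _≟ᵇ_)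
open import Data.Fin.Base using (Fin; zero; suc; toℕ; _↑ˡ_)
open import Data.Fin.Properties using (toℕ-injective; toℕ-↑ˡ; toℕ≤pred[n])
  renaming (_≟_ to _≟ᶠ_; suc-injective to sucᶠ-injective)
open import Data.Fin.Subset using (Subset; inside; outside; ∣_∣; _∈_; _-_)
open import Data.Fin.Subset.Properties using (x∈p⇒∣p-x∣<∣p∣; x∈p∧x≢y⇒x∈p-y)
open import Data.Integer.Base as ℤ using (+_)
import Data.Integer.Properties as ℤ
open import Data.Integer.Tactic.RingSolver using () renaming (solve-∀ to solve-∀ᶻ)
open import Data.List.Base
  using (List; []; _∷_; _++_; length; filter; map; cartesianProductWith)
open import Data.List.Membership.Propositional using (lose) renaming (_∈_ to _∈ˡ_)
open import Data.List.Membership.Propositional.Properties using (∈-filter⁻)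
open import Data.List.Properties
  using (length-++; length-map; filter-++;
         filter-none; filter-notAll; length-filter)
import Data.List.Relation.Binary.Sublist.Propositional as Sublist
open import Data.List.Relation.Binary.Sublist.Propositional.Properties using (filter⁺; length-mono-≤)
open import Data.List.Relation.Unary.All using (universal)
open import Data.List.Relation.Unary.Any using (here; there)
open import Data.Nat.Base
  using (ℕ; zero; suc; pred; NonZero; >-nonZero⁻¹; _+_; _*_; _^_; _⊔_; _≤_; _<_; z≤n;
         _/_; _%_)
open import Data.Nat.Coprimality using (1-coprimeTo; sym)
open import Data.Nat.Divisibility using (_∣_; _∣0)
open import Data.Nat.DivMod using (m≡m%n+[m/n]*n; m%n<n; m/n*n≤m)
open import Data.Nat.Properties renaming (_≟_ to _≟ⁿ_)
open import Data.Nat.Tactic.RingSolver using (solve-∀)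
open import Data.Product.Base using (Σ-syntax; ∃-syntax; _×_; _,_; proj₁; proj₂)
open import Data.Rational as ℚ using (ℚ; mkℚ; 0ℚ; 1ℚ; *<*)
import Data.Rational.Properties as ℚ
import Data.Rational.Unnormalised.Base as ℚᵘ
import Data.Rational.Unnormalised.Properties as ℚᵘ
open import Data.Vec.Base as Vec using (Vec; []; _∷_; lookup; replicate)
open import Data.Vec.Properties using (≡-dec; lookup-++ˡ; lookup-replicate)
open import Function.Base using (_∘_)
open import Function.Definitions using (Injective)
open import Level using (0ℓ)
open import Relation.Binary.Definitions using (DecidableEquality)
open import Relation.Binary.PropositionalEquality as ≡
  using (_≡_; _≢_; refl; cong; cong₂; subst; subst₂; module ≡-Reasoning)
open import Relation.Nullary.Decidable using (yes; no; ¬?; does)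
open import Relation.Nullary.Negation using (¬_; contradiction)
open import Relation.Unary using (Pred; Decidable)

-- Counting in lists of products and vectors.

count : ∀ {A : Set} {P : Pred A 0ℓ} → Decidable P → List A → ℕ
count P? xs = length (filter P? xs)

module _ {A : Set} {P Q : Pred A 0ℓ} (P? : Decidable P) (Q? : Decidable Q) where

  count-mono : (∀ {x} → P x → Q x) → ∀ xs → count P? xs ≤ count Q? xs
  count-mono P⇒Q xs = length-mono-≤
    (filter⁺ P? Q? (λ { refl → P⇒Q }) (Sublist.⊆-refl {x = xs}))

count-none : ∀ {A : Set} {P : Pred A 0ℓ} (P? : Decidable P) →
             (∀ x → ¬ P x) → ∀ xs → count P? xs ≡ 0
count-none P? ¬P xs = cong length (filter-none P? (universal ¬P xs))

count-map : ∀ {A B : Set} {P : Pred B 0ℓ} (P? : Decidable P) (f : A → B) xs →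
            count P? (map f xs) ≡ count (P? ∘ f) xs
count-map P? f []       = refl
count-map P? f (x ∷ xs) with ih ← count-map P? f xs | does (P? (f x))
... | true  = cong suc ih
... | false = ih

module _ {A B C : Set} {P : Pred C 0ℓ} (P? : Decidable P) (f : A → B → C) where

  count-cartesianProductWith : ∀ x xs ys →
    count P? (cartesianProductWith f (x ∷ xs) ys) ≡
    count (P? ∘ f x) ys + count P? (cartesianProductWith f xs ys)
  count-cartesianProductWith x xs ys = begin
    count P? (map (f x) ys ++ zs)             ≡⟨ cong length (filter-++ P? (map (f x) ys) zs) ⟩
    length (filter P? (map (f x) ys) ++ _)    ≡⟨ length-++ (filter P? (map (f x) ys)) ⟩
    count P? (map (f x) ys) + count P? zs     ≡⟨ cong (_+ count P? zs) (count-map P? (f x) ys) ⟩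
    count (P? ∘ f x) ys + count P? zs         ∎
    where
    open ≡-Reasoning
    zs = cartesianProductWith f xs ys

  -- Sums over the heads a bound K / M on each fibre, with the denominator cleared to stay in ℕ. The
  -- fibre bound is asked for members of `xs` only, since an entry outside `xs` cannot start a
  -- `ConstantWindow`.
  count-cartesianProductWith-≤ : ∀ {M K} xs ys →
    (∀ {x} → x ∈ˡ xs → count (P? ∘ f x) ys * M ≤ K) →
    count P? (cartesianProductWith f xs ys) * M ≤ length xs * K
  count-cartesianProductWith-≤ []       ys h = z≤n
  count-cartesianProductWith-≤ {M} {K} (x ∷ xs) ys h = begin
    count P? (cartesianProductWith f (x ∷ xs) ys) * M
      ≡⟨ cong (_* M) (count-cartesianProductWith x xs ys) ⟩
    (count (P? ∘ f x) ys + count P? (cartesianProductWith f xs ys)) * M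
      ≡⟨ *-distribʳ-+ M (count (P? ∘ f x) ys) _ ⟩
    count (P? ∘ f x) ys * M + count P? (cartesianProductWith f xs ys) * M
      ≤⟨ +-mono-≤ (h (here refl)) (count-cartesianProductWith-≤ xs ys (h ∘ there)) ⟩
    K + length xs * K ∎
    where open ≤-Reasoning

count-cartesianProductWith-mono :
  ∀ {A B C D E : Set} {P : Pred C 0ℓ} {Q : Pred E 0ℓ} (P? : Decidable P) (Q? : Decidable Q)
  (f : A → B → C) (g : A → D → E) {M K} xs ys zs →
  (∀ x → count (P? ∘ f x) ys * M ≤ count (Q? ∘ g x) zs * K) →
  count P? (cartesianProductWith f xs ys) * M ≤ count Q? (cartesianProductWith g xs zs) * K
count-cartesianProductWith-mono P? Q? f g []       ys zs h = z≤n
count-cartesianProductWith-mono P? Q? f g {M} {K} (x ∷ xs) ys zs h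
  rewrite count-cartesianProductWith P? f x xs ys
        | count-cartesianProductWith Q? g x xs zs
        | *-distribʳ-+ M (count (P? ∘ f x) ys) (count P? (cartesianProductWith f xs ys))
        | *-distribʳ-+ K (count (Q? ∘ g x) zs) (count Q? (cartesianProductWith g xs zs))
  = +-mono-≤ (h x) (count-cartesianProductWith-mono P? Q? f g xs ys zs h)

length-allVecs : ∀ {A : Set} (xs : List A) n → length (allVecs xs n) ≡ length xs ^ n
length-allVecs xs zero    = refl
length-allVecs xs (suc n) = ≡.trans (go xs) (cong (length xs *_) (length-allVecs xs n))
  where
  go : ∀ zs → length (cartesianProductWith _∷_ zs (allVecs xs n)) ≡ length zs * length (allVecs xs n)
  go []       = refl
  go (z ∷ zs) = ≡.trans (length-++ (map (z ∷_) (allVecs xs n)))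
    (cong₂ _+_ (length-map (z ∷_) (allVecs xs n)) (go zs))

-- K / M is the bound on the number of extensions of a prefix.
count-prefix-≤ : ∀ {A : Set} (xs : List A) k n {P : Pred (Vec A (k + n)) 0ℓ} {Q : Pred (Vec A k) 0ℓ}
  (P? : Decidable P) (Q? : Decidable Q) {M K} →
  (∀ u v → P (u Vec.++ v) → Q u) →
  (∀ u → count (P? ∘ (u Vec.++_)) (allVecs xs n) * M ≤ K) →
  count P? (allVecs xs (k + n)) * M ≤ count Q? (allVecs xs k) * K
count-prefix-≤ xs zero n P? Q? P⇒Q h with Q? []
... | yes _ = ≤-trans (h []) (m≤m+n _ 0)
... | no ¬Q rewrite count-none P? (λ v → ¬Q ∘ P⇒Q [] v) (allVecs xs n) = z≤n
count-prefix-≤ xs (suc k) n P? Q? P⇒Q h =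
  count-cartesianProductWith-mono P? Q? _∷_ _∷_ xs (allVecs xs (k + n)) (allVecs xs k)
    λ x → count-prefix-≤ xs k n (P? ∘ (x ∷_)) (Q? ∘ (x ∷_)) (λ u v → P⇒Q (x ∷ u) v) (λ u → h (x ∷ u))

-- Vectors without a constant window.

-- Membership of the repeated entry in `xs` is recorded because, for `subsetsOfSize c s`, it is what
-- yields the size of the common list.
data ConstantWindow {A : Set} (xs : List A) (d : ℕ) : ∀ {n} → Vec A n → Set where
  here  : ∀ {n x} → x ∈ˡ xs → (v : Vec A n) → ConstantWindow xs d (replicate d x Vec.++ v)
  there : ∀ {n} x {v : Vec A n} → ConstantWindow xs d v → ConstantWindow xs d (x ∷ v)

skip : ∀ {A : Set} {xs : List A} {d k n} (u : Vec A k) {v : Vec A n} →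
       ConstantWindow xs d v → ConstantWindow xs d (u Vec.++ v)
skip []      w = w
skip (x ∷ u) w = there x (skip u w)

-- Trades the inductive witness for explicit positions, so that adjacency inside the window becomes
-- arithmetic on `i + toℕ j`.
ConstantWindow⇒indices : ∀ {A : Set} {xs : List A} {d n} {v : Vec A n} → ConstantWindow xs d v →
  ∃[ x ] x ∈ˡ xs × ∃[ i ] Σ[ g ∈ (Fin d → Fin n) ]
    (∀ j → toℕ (g j) ≡ i + toℕ j) × (∀ j → lookup v (g j) ≡ x)
ConstantWindow⇒indices {d = d} (here {n} {x} x∈xs v) =
  x , x∈xs , 0 , (_↑ˡ n) , (λ j → toℕ-↑ˡ j n) ,
  λ j → ≡.trans (lookup-++ˡ (replicate d x) v j) (lookup-replicate j x)
ConstantWindow⇒indices (there _ w) with ConstantWindow⇒indices w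
... | x , x∈xs , i , g , g≡ , v≡ = x , x∈xs , suc i , suc ∘ g , cong suc ∘ g≡ , v≡

module _ {A : Set} (_≟_ : DecidableEquality A) (xs : List A) (c : ℕ)
         {a} (N^c≡1+a : length xs ^ c ≡ suc a) where

  private N = length xs

  -- Induction over disjoint blocks of `suc c` entries, each costing a factor a / (a + 1). Once the
  -- head x of a block is fixed, at most a of the N ^ c = `suc a` choices for its other c entries
  -- avoid a constant block, and the rest of the vector is again free of windows. Entries left over
  -- after the last block are bounded trivially by the base case.
  count-noConstantWindow : ∀ m {n} → m * suc c ≤ n → {P : Pred (Vec A n) 0ℓ} (P? : Decidable P) →
    (∀ v → P v → ¬ ConstantWindow xs (suc c) v) →
    count P? (allVecs xs n) * suc a ^ m ≤ a ^ m * N ^ n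
  count-noConstantWindow zero {n} _ P? _ = begin
    count P? (allVecs xs n) * 1   ≡⟨ *-identityʳ _ ⟩
    count P? (allVecs xs n)       ≤⟨ length-filter P? (allVecs xs n) ⟩
    length (allVecs xs n)         ≡⟨ length-allVecs xs n ⟩
    N ^ n                         ≡⟨ *-identityˡ _ ⟨
    1 * N ^ n                     ∎
    where
    open ≤-Reasoning
  count-noConstantWindow (suc m) p P? h with m≤n⇒∃[o]m+o≡n (m+n≤o⇒m≤o (suc c) p)
  ... | n , refl = begin
    count P? (allVecs xs (suc c + n)) * (suc a * suc a ^ m)
      ≡⟨ cong (count P? (allVecs xs (suc c + n)) *_) (*-comm (suc a) _) ⟩
    count P? (allVecs xs (suc c + n)) * (suc a ^ m * suc a)
      ≡⟨ *-assoc (count P? (allVecs xs (suc c + n))) _ _ ⟨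
    count P? (allVecs xs (suc c + n)) * suc a ^ m * suc a
      ≤⟨ *-monoˡ-≤ (suc a) (count-cartesianProductWith-≤ P? _∷_ xs (allVecs xs (c + n)) fibre) ⟩
    N * (a * (a ^ m * N ^ n)) * suc a
      -- The spare factor `suc a` becomes `N ^ c` again, which completes the power
      -- `N ^ (suc c + n)`.
      ≡⟨ cong (N * (a * (a ^ m * N ^ n)) *_) N^c≡1+a ⟨
    N * (a * (a ^ m * N ^ n)) * N ^ c
      ≡⟨ rearrange N a (a ^ m) (N ^ n) (N ^ c) ⟩
    a * a ^ m * (N * (N ^ c * N ^ n))
      ≡⟨ cong (λ z → a * a ^ m * (N * z)) (^-distribˡ-+-* N c n) ⟨
    a * a ^ m * N ^ (suc c + n) ∎
    where
    open ≤-Reasoning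

    rearrange : ∀ N a b x y → N * (a * (b * x)) * y ≡ a * b * (N * (y * x))
    rearrange = solve-∀

    ≢replicate? : ∀ x → Decidable (_≢ replicate c x)
    ≢replicate? x u = ¬? (≡-dec _≟_ u (replicate c x))

    -- The constant vector occurs among the 1 + a entries of `allVecs xs c`, so the filter drops at
    -- least one of them.
    count-≢replicate : ∀ {x} → x ∈ˡ xs → count (≢replicate? x) (allVecs xs c) ≤ a
    count-≢replicate {x} x∈xs = ≤-pred (subst (count (≢replicate? x) (allVecs xs c) <_)
      (≡.trans (length-allVecs xs c) N^c≡1+a)
      (filter-notAll (≢replicate? x) (allVecs xs c)
        (lose (∈-allVecs c (replicate c x)
                (λ i → subst (_∈ˡ xs) (≡.sym (lookup-replicate i x)) x∈xs))
              λ ≢ → ≢ refl)))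

    fibre : ∀ {x} → x ∈ˡ xs →
            count (P? ∘ (x ∷_)) (allVecs xs (c + n)) * suc a ^ m ≤ a * (a ^ m * N ^ n)
    fibre {x} x∈xs = ≤-trans
      (count-prefix-≤ xs c n (P? ∘ (x ∷_)) (≢replicate? x)
        -- If the c entries after the head were all x, the vector would begin with a constant
        -- window; a window further on is carried back by `skip`.
        (λ { u v Pxuv refl → h _ Pxuv (here x∈xs v) })
        (λ u → count-noConstantWindow m (+-cancelˡ-≤ (suc c) _ _ p) (λ v → P? (x ∷ u Vec.++ v))
          (λ v Pxuv w → h _ Pxuv (skip (x ∷ u) w))))
      (*-monoˡ-≤ (a ^ m * N ^ n) (count-≢replicate x∈xs))

-- Constant windows prevent colouring.

-- Pigeonhole: removing `g zero` makes `p` strictly smaller, and injectivity keeps the other values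
-- of `g` inside.
injective⇒≤∣p∣ : ∀ {m s} (p : Subset s) (g : Fin m → Fin s) → Injective _≡_ _≡_ g →
                 (∀ i → g i ∈ p) → m ≤ ∣ p ∣
injective⇒≤∣p∣ {zero}  p g inj g∈p = z≤n
injective⇒≤∣p∣ {suc m} p g inj g∈p = ≤-<-trans
  (injective⇒≤∣p∣ (p - g zero) (g ∘ suc) (sucᶠ-injective ∘ inj)
    λ i → x∈p∧x≢y⇒x∈p-y (g∈p (suc i)) λ eq → contradiction (inj eq) λ ())
  (x∈p⇒∣p-x∣<∣p∣ (g∈p zero))

-- The residue a - b is the exact difference of the positions, with no wrapping round the cycle, so
-- the divisibility is that of zero. It is nonzero as a ≢ b, and bounded by max(a, b) ≤ c ≤ k.
close⇒CycleAdj : ∀ {n k c} i {a b} → c ≤ k → a ≤ c → b ≤ c → a ≢ b →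
  (x y : Fin n) → toℕ x ≡ i + a → toℕ y ≡ i + b → CycleAdj n k x y
close⇒CycleAdj {n} i {a} {b} c≤k a≤c b≤c a≢b x y x≡ y≡ =
  (λ { refl → a≢b (+-cancelˡ-≡ i a b (≡.trans (≡.sym x≡) y≡)) }) ,
  d , n≢0⇒n>0 (a≢b ∘ ℤ.+-injective ∘ ℤ.i-j≡0⇒i≡j _ _ ∘ ℤ.∣i∣≡0⇒i≡0) ,
  ≤-trans (subst (λ z → ℤ.∣ z ∣ ≤ a ⊔ b) (≡.sym (ℤ.m-n≡m⊖n a b)) (ℤ.∣m⊝n∣≤m⊔n a b))
          (≤-trans (⊔-lub a≤c b≤c) c≤k) ,
  subst (λ z → n ∣ ℤ.∣ z ∣) (≡.sym diff≡0) (n ∣0)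
  where
  d = + a ℤ.- + b

  cancel : ∀ i a b → ((i ℤ.+ a) ℤ.- (i ℤ.+ b)) ℤ.- (a ℤ.- b) ≡ ℤ.0ℤ
  cancel = solve-∀ᶻ

  diff≡0 : (+ toℕ x ℤ.- + toℕ y) ℤ.- d ≡ ℤ.0ℤ
  diff≡0 rewrite x≡ | y≡ = cancel (+ i) (+ a) (+ b)

-- Properness on a clique makes the colouring injective there, which would place c + 1 colours in
-- one set of size c.
ConstantWindow⇒¬ListColourable : ∀ {n k c s} → c ≤ k → (L : Vec (Subset s) n) →
  ConstantWindow (subsetsOfSize c s) (suc c) L → ¬ ListColourable (CycleAdj n k) (lookup L)
ConstantWindow⇒¬ListColourable {k = k} {c} c≤k L w (f , f∈L , f-proper)
  with ConstantWindow⇒indices w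
... | p , p∈ , i , g , g≡ , L≡p = 1+n≰n (subst (suc c ≤_) ∣p∣≡c
    (injective⇒≤∣p∣ p (f ∘ g) f∘g-injective λ j → subst (f (g j) ∈_) (L≡p j) (f∈L (g j))))
  where
  ∣p∣≡c = proj₂ (∈-filter⁻ (λ q → ∣ q ∣ ≟ⁿ c) {xs = allVecs (inside ∷ outside ∷ []) _} p∈)

  f∘g-injective : Injective _≡_ _≡_ (f ∘ g)
  f∘g-injective {j} {j′} eq with j ≟ᶠ j′
  ... | yes j≡j′ = j≡j′
  ... | no  j≢j′ = contradiction eq (f-proper (g j) (g j′)
    -- Offsets in `Fin (suc c)` are at most c: a window of c + 1 vertices is the longest for which c
    -- ≤ k alone ensures adjacency.
    (close⇒CycleAdj i c≤k (toℕ≤pred[n] j) (toℕ≤pred[n] j′) (j≢j′ ∘ toℕ-injective)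
      (g j) (g j′) (g≡ j) (g≡ j′)))

-- Numerical bounds.

-- Pascal's recursion on the first colour: the two halves for size c + 1 are at most s ^ c and s ^
-- (c + 1), which fit into (1 + s) ^ (c + 1) = (1 + s) ^ c + s * (1 + s) ^ c.
length-subsetsOfSize-≤ : ∀ c s → length (subsetsOfSize c s) ≤ s ^ c
length-subsetsOfSize-≤ zero    zero    = ≤-refl
length-subsetsOfSize-≤ (suc c) zero    = z≤n
length-subsetsOfSize-≤ c       (suc s) = begin
  length (subsetsOfSize c (suc s))
    ≡⟨ count-cartesianProductWith (size? c) _∷_ inside (outside ∷ []) subsets ⟩
  with-inside + count (size? c) (map (outside ∷_) subsets ++ [])
    ≡⟨ cong (_+_ with-inside) (count-cartesianProductWith (size? c) _∷_ outside [] subsets) ⟩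
  with-inside + (with-outside + 0)
    ≡⟨ cong (_+_ with-inside) (+-identityʳ with-outside) ⟩
  with-inside + with-outside
    ≤⟨ bound c ⟩
  suc s ^ c ∎
  where
  open ≤-Reasoning
  size? : ∀ c {s} → Decidable {A = Subset s} (λ p → ∣ p ∣ ≡ c)
  size? c p = ∣ p ∣ ≟ⁿ c
  subsets = allVecs (inside ∷ outside ∷ []) s
  with-inside = count (size? c ∘ (inside ∷_)) subsets
  with-outside = count (size? c ∘ (outside ∷_)) subsets

  bound : ∀ c → count (size? c ∘ (inside ∷_)) subsets + count (size? c ∘ (outside ∷_)) subsets ≤ suc s ^ c
  bound zero = +-mono-≤ (≤-reflexive (count-none (size? 0 ∘ (inside ∷_)) (λ _ ()) subsets))
    (length-subsetsOfSize-≤ zero s)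
  bound (suc c) = +-mono-≤
    (≤-trans (count-mono (size? (suc c) ∘ (inside ∷_)) (size? c) suc-injective subsets)
      (≤-trans (length-subsetsOfSize-≤ c s) (^-monoˡ-≤ c (n≤1+n s))))
    (≤-trans (length-subsetsOfSize-≤ (suc c) s) (*-monoʳ-≤ s (^-monoˡ-≤ c (n≤1+n s))))

-- (1 - 1 / A) ^ m ≤ A / (A + m) for A = suc a.
bernoulli : ∀ a m → a ^ m * (suc a + m) ≤ suc a ^ m * suc a
bernoulli a zero    = ≤-reflexive (cong (1 *_) (+-identityʳ (suc a)))
bernoulli a (suc m) = begin
  a * a ^ m * (suc a + suc m)           ≡⟨ move a (a ^ m) (suc a + suc m) ⟩
  a ^ m * (a * (suc a + suc m))         ≤⟨ *-monoʳ-≤ (a ^ m) step ⟩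
  a ^ m * (suc a * (suc a + m))         ≡⟨ move (suc a) (a ^ m) (suc a + m) ⟨
  suc a * a ^ m * (suc a + m)           ≡⟨ *-assoc (suc a) (a ^ m) (suc a + m) ⟩
  suc a * (a ^ m * (suc a + m))         ≤⟨ *-monoʳ-≤ (suc a) (bernoulli a m) ⟩
  suc a * (suc a ^ m * suc a)           ≡⟨ *-assoc (suc a) (suc a ^ m) (suc a) ⟨
  suc a * suc a ^ m * suc a             ∎
  where
  open ≤-Reasoning

  move : ∀ x y z → x * y * z ≡ y * (x * z)
  move = solve-∀

  expand : ∀ a m → a * (suc a + suc m) + suc m ≡ suc a * (suc a + m)
  expand = solve-∀

  step : a * (suc a + suc m) ≤ suc a * (suc a + m)
  step = subst (a * (suc a + suc m) ≤_) (expand a m) (m≤m+n _ (suc m))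

-- With A = `suc a`, the chain C / T ≤ (1 - 1 / A) ^ m ≤ A / (A + m) and m ≥ W * A give C / T ≤ 1 /
-- (1 + W).
ratio-bound : ∀ {C T W a m} → C * suc a ^ m ≤ a ^ m * T → W * suc a ≤ m → C * suc W ≤ T
ratio-bound {C} {T} {W} {a} {m} counted W≤ =
  *-cancelʳ-≤ (C * suc W) T (suc a ^ m * suc a) {{m*n≢0 (suc a ^ m) (suc a) {{m^n≢0 (suc a) m}}}} (begin
    C * suc W * (suc a ^ m * suc a)      ≡⟨ move C W (suc a ^ m) (suc a) ⟩
    C * suc a ^ m * (suc a + W * suc a)  ≤⟨ *-mono-≤ counted (+-monoʳ-≤ (suc a) W≤) ⟩
    a ^ m * T * (suc a + m)              ≡⟨ swap (a ^ m) T (suc a + m) ⟩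
    T * (a ^ m * (suc a + m))            ≤⟨ *-monoʳ-≤ T (bernoulli a m) ⟩
    T * (suc a ^ m * suc a)              ∎)
  where
  open ≤-Reasoning

  move : ∀ C W x y → C * suc W * (x * y) ≡ C * x * (y + W * y)
  move = solve-∀

  swap : ∀ x T y → x * T * y ≡ T * (x * y)
  swap = solve-∀

n*[1+m]≤o⇒n*m<o : ∀ n {m o} .{{_ : NonZero o}} → n * suc m ≤ o → n * m < o
n*[1+m]≤o⇒n*m<o zero    {o = o} _  = >-nonZero⁻¹ o
n*[1+m]≤o⇒n*m<o (suc n) {m}     le = <-≤-trans (*-monoʳ-< (suc n) (n<1+n m)) le

-- Passing between rationals and natural numbers.

fromℕ≡mkℚ : ∀ n → fromℕ n ≡ mkℚ (+ n) 0 (sym (1-coprimeTo n))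
fromℕ≡mkℚ n = ℚ.normalize-coprime (sym (1-coprimeTo n))

fromℕ-* : ∀ m n → fromℕ (m * n) ≡ fromℕ m ℚ.* fromℕ n
fromℕ-* m n rewrite fromℕ≡mkℚ m | fromℕ≡mkℚ n = cong (ℚ._/ 1) (ℤ.pos-* m n)

fromℕ-^ : ∀ m n → fromℕ (m ^ n) ≡ fromℕ m ^ℚ n
fromℕ-^ m zero    = refl
fromℕ-^ m (suc n) = ≡.trans (fromℕ-* m (m ^ n)) (cong (fromℕ m ℚ.*_) (fromℕ-^ m n))

fromℕ-cancel-< : ∀ {m n} → fromℕ m ℚ.< fromℕ n → m < n
fromℕ-cancel-< {m} {n} m<n rewrite fromℕ≡mkℚ m | fromℕ≡mkℚ n with *<* lt ← m<n =
  ℤ.drop‿+<+ (subst₂ ℤ._<_ (ℤ.*-identityʳ (+ m)) (ℤ.*-identityʳ (+ n)) lt)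

fromℕ-positive : ∀ n .{{_ : NonZero n}} → ℚ.Positive (fromℕ n)
fromℕ-positive n = ℚ.normalize-pos n 1

fromℕ-^-inverse : ∀ d y → fromℕ d ℚ.* y ≡ 1ℚ → ∀ m → fromℕ (d ^ m) ℚ.* y ^ℚ m ≡ 1ℚ
fromℕ-^-inverse d y dy≡1 zero    = refl
fromℕ-^-inverse d y dy≡1 (suc m) = begin
  fromℕ (d * d ^ m) ℚ.* (y ℚ.* y ^ℚ m)
    ≡⟨ cong (ℚ._* (y ℚ.* y ^ℚ m)) (fromℕ-* d (d ^ m)) ⟩
  (fromℕ d ℚ.* fromℕ (d ^ m)) ℚ.* (y ℚ.* y ^ℚ m)
    ≡⟨ interchange (CommutativeMonoid.commutativeSemigroup ℚ.*-1-commutativeMonoid)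
         (fromℕ d) (fromℕ (d ^ m)) y (y ^ℚ m) ⟩
  (fromℕ d ℚ.* y) ℚ.* (fromℕ (d ^ m) ℚ.* y ^ℚ m)
    ≡⟨ cong₂ ℚ._*_ dy≡1 (fromℕ-^-inverse d y dy≡1 m) ⟩
  1ℚ ∎
  where open ≡-Reasoning

-- Taking ε = 1 / d and multiplying by d ^ m cancels ε ^ m, which leaves an inequality between
-- natural numbers.
IsLittleORoot⇒eventually-< : ∀ {s m} → IsLittleORoot s m → ∀ d .{{_ : NonZero d}} →
  ∃[ n₀ ] ∀ n → n₀ ≤ n → d ^ m * s n ^ m < n
IsLittleORoot⇒eventually-< {s} {m} s-small d = proj₁ small , λ n n₀≤n → fromℕ-cancel-< (begin-strict
  fromℕ (d ^ m * s n ^ m)             ≡⟨ fromℕ-* (d ^ m) (s n ^ m) ⟩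
  fromℕ (d ^ m) ℚ.* fromℕ (s n ^ m)   ≡⟨ cong (fromℕ (d ^ m) ℚ.*_) (fromℕ-^ (s n) m) ⟩
  fromℕ (d ^ m) ℚ.* fromℕ (s n) ^ℚ m
    <⟨ ℚ.*-monoʳ-<-pos (fromℕ (d ^ m)) (proj₂ small n n₀≤n) ⟩
  fromℕ (d ^ m) ℚ.* (y ^ℚ m ℚ.* fromℕ n)
    ≡⟨ ℚ.*-assoc (fromℕ (d ^ m)) (y ^ℚ m) (fromℕ n) ⟨
  (fromℕ (d ^ m) ℚ.* y ^ℚ m) ℚ.* fromℕ n
    ≡⟨ cong (ℚ._* fromℕ n) (fromℕ-^-inverse d y (ℚ.*-inverseʳ (fromℕ d)) m) ⟩
  1ℚ ℚ.* fromℕ n                      ≡⟨ ℚ.*-identityˡ (fromℕ n) ⟩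
  fromℕ n                             ∎)
  where
  open ℚ.≤-Reasoning
  instance
    d-positive : ℚ.Positive (fromℕ d)
    d-positive = fromℕ-positive d
    d^m-positive : ℚ.Positive (fromℕ (d ^ m))
    d^m-positive = fromℕ-positive (d ^ m) {{m^n≢0 d m}}
    d-nonZero : ℚ.NonZero (fromℕ d)
    d-nonZero = ℚ.pos⇒nonZero (fromℕ d)
  y = ℚ.1/ fromℕ d
  small = s-small y (ℚ.positive⁻¹ y {{ℚ.1/pos⇒pos (fromℕ d)}})

-- A positive ε has numerator at least 1, so being below the reciprocal of its denominator is
-- enough.
∣m/n∣<ε : ∀ m n .{{_ : NonZero n}} {ε} → 0ℚ ℚ.< ε → m * ℚ.↧ₙ ε < n → ℚ.∣ + m ℚ./ n ∣ ℚ.< ε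
∣m/n∣<ε m n@(suc n-1) {ε@(mkℚ e d _)} 0<ε lt
  rewrite ℚ.0≤p⇒∣p∣≡p (ℚ.nonNegative⁻¹ (+ m ℚ./ n) {{ℚ.normalize-nonNeg m n}}) =
  ℚ.toℚᵘ-cancel-< (ℚᵘ.<-respˡ-≃ (ℚᵘ.≃-sym (ℚ.toℚᵘ-fromℚᵘ (ℚᵘ.mkℚᵘ (+ m) n-1)))
    (ℚᵘ.*<* (cross e (ℚ.positive 0<ε))))
  where
  cross : ∀ e → ℤ.Positive e → + m ℤ.* + suc d ℤ.< e ℤ.* + n
  cross ℤ.+[1+ p ] _ = subst₂ ℤ._<_ (ℤ.pos-* m (suc d)) (ℤ.pos-* (suc p) n)
    (ℤ.+<+ (<-≤-trans lt (m≤n*m n (suc p))))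

-- Combining the estimates.

proposition2p1 : (c k : ℕ) → 1 ≤ c → 1 ≤ k → c ≤ k →
    (s : ℕ → ℕ) (c≤s : ∀ n → c ≤ s n) →
    IsLittleORoot s (c * c) →
    TendsToZero (λ n → colourProb n c k (s n) (c≤s n))
proposition2p1 c k 1≤c _ c≤k s c≤s s-small ε 0<ε = proj₁ large , main
  where
  e = ℚ.↧ₙ ε
  d = suc c
  -- The factor e, the denominator of ε, sets the required precision; d pays for having only n / d
  -- disjoint windows.
  large = IsLittleORoot⇒eventually-< {s} {c * c} s-small (e * d)

  main : ∀ n → proj₁ large ≤ n → ℚ.∣ colourProb n c k (s n) (c≤s n) ∣ ℚ.< ε
  main n n₀≤n = ∣m/n∣<ε C T {{T-nonZero}} 0<ε C*e<T
    where
    lists = subsetsOfSize c (s n)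
    N = length lists
    a = pred (N ^ c)
    m = n / d

    T-nonZero : NonZero (length (listAssignments n c (s n)))
    T-nonZero = listAssignments-nonZero n (c≤s n)

    T = length (listAssignments n c (s n))
    colourable? : Decidable (λ (L : Vec (Subset (s n)) n) → ListColourable (CycleAdj n k) (lookup L))
    colourable? L = listColourable? (cycleAdj? n k) (lookup L)
    C = count colourable? (listAssignments n c (s n))

    N-nonZero : NonZero N
    -- Assignments to a single vertex number N ^ 1, and there is at least one.
    N-nonZero = subst NonZero (≡.trans (length-allVecs lists 1) (*-identityʳ N))
      (listAssignments-nonZero 1 (c≤s n))

    N^c≡1+a : N ^ c ≡ suc a
    N^c≡1+a = ≡.sym (suc-pred (N ^ c) {{m^n≢0 N c {{N-nonZero}}}})

    counted : C * suc a ^ m ≤ a ^ m * T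
    counted = subst (λ t → C * suc a ^ m ≤ a ^ m * t) (≡.sym (length-allVecs lists n))
      (count-noConstantWindow (≡-dec _≟ᵇ_) lists c N^c≡1+a m (m/n*n≤m n d) colourable?
        (λ L colourable w → ConstantWindow⇒¬ListColourable c≤k L w colourable))

    e*[1+a]≤m : e * suc a ≤ m
    -- With A = `suc a`, the chain gives e * A * d < (m + 1) * d; cancelling d absorbs the rounding
    -- in m = n / d.
    e*[1+a]≤m = ≤-pred (*-cancelʳ-< d (e * suc a) (suc m) (begin-strict
      e * suc a * d                      ≡⟨ swap e (suc a) d ⟩
      e * d * suc a                      ≡⟨ cong (e * d *_) N^c≡1+a ⟨
      e * d * N ^ c                      ≤⟨ *-mono-≤ e*d≤ (^-monoˡ-≤ c (length-subsetsOfSize-≤ c (s n))) ⟩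
      (e * d) ^ (c * c) * (s n ^ c) ^ c  ≡⟨ cong ((e * d) ^ (c * c) *_) (^-*-assoc (s n) c c) ⟩
      (e * d) ^ (c * c) * s n ^ (c * c)  <⟨ proj₂ large n n₀≤n ⟩
      n                                  ≡⟨ m≡m%n+[m/n]*n n d ⟩
      n % d + m * d                      <⟨ +-monoˡ-< (m * d) (m%n<n n d) ⟩
      suc m * d                          ∎))
      where
      open ≤-Reasoning

      swap : ∀ x y z → x * y * z ≡ x * z * y
      swap = solve-∀

      e*d≤ : e * d ≤ (e * d) ^ (c * c)
      -- The smallness of s supplies the factor e * d raised to c * c; since c * c ≥ 1, this is at
      -- least the single factor used here.
      e*d≤ = ≤-trans (≤-reflexive (≡.sym (^-identityʳ (e * d)))) (^-monoʳ-≤ (e * d) (*-mono-≤ 1≤c 1≤c))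

    C*e<T : C * e < T
    -- W = e gives C * (1 + e) ≤ T; the extra C makes the inequality strict, and when C = 0
    -- strictness comes from T being nonzero.
    C*e<T = n*[1+m]≤o⇒n*m<o C {e} {T} {{T-nonZero}} (ratio-bound {C} {T} {e} counted e*[1+a]≤m)
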